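{- Let $k\ge\ell\ge\ell'\ge t\ge1$ be integers, let $\mathcal{F}\subseteq\{F\subseteq[k]:|F|\le\ell\}$ and $\mathcal{G}\subseteq\{G\subseteq[k]:|G|\le\ell'\}$ be non-empty cross $t$-intersecting families, and for $i\in[2]$ let $\omega_i:[0,k]\to\mathbb{R}_{\ge0}$ be non-increasing functions. Then $$\omega_1(\mathcal{F})+\omega_2(\mathcal{G})\le\max\Big\{\max_{a\in[t,\ell']}\{\omega_1(\mathcal{K}_k(a,\ell,t))+\omega_2(\mathcal{S}_k(a,\ell'))\},\ \max_{a\in[t,\ell]}\{\omega_1(\mathcal{S}_k(a,\ell))+\omega_2(\mathcal{K}_k(a,\ell',t))\}\Big\},$$ where $\mathcal{K}_k(a,s,t)=\{K\subseteq[k]:|K|\le s,\ |K\cap[a]|\ge t\}$ and $\mathcal{S}_k(a,s)=\{S\subseteq[k]:|S|\le s,\ [a]\subseteq S\}$.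
   Context: $[p,q]=\{p,\dots,q\}$, $[q]=[1,q]$. Families are cross $t$-intersecting if $|F\cap G|\ge t$ for all $F\in\mathcal{F},G\in\mathcal{G}$. For $\omega:[0,k]\to\mathbb{R}_{\ge0}$, $\omega(F)=\omega(|F|)$ and $\omega(\mathcal{F})=\sum_{F\in\mathcal{F}}\omega(F)$; non-increasing means $\omega(i)\ge\omega(j)$ whenever $i\le j$. -}

module Defs where

open import Data.Fin.Base as Fin using (Fin; toℕ; fromℕ<)
open import Data.Fin.Subset using (Subset; inside; outside; _⊆_; _∩_; ∣_∣)
open import Data.Fin.Subset.Properties using (_⊆?_; ∣p∣≤n)
open import Data.List.Base using (List; []; _∷_; _++_; map; filter; foldr)
open import Data.Nat.Base as ℕ using (ℕ; zero; suc; s≤s)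
import Data.Nat.Properties as ℕ
open import Data.Product.Base using (∃-syntax; _×_; _,_)
open import Data.Rational.Base as ℚ using (ℚ; 0ℚ; ½)
import Data.Rational.Properties as ℚ
open import Data.Rational.Solver using (module +-*-Solver)
open import Data.Sum.Base using (inj₁; inj₂)
open import Data.Vec.Base as Vec using (tabulate)
open import Function.Base using (_∘_)
open import Level using (0ℓ)
open import Relation.Binary.PropositionalEquality
  using (_≡_; refl; sym; trans; cong)
open import Relation.Nullary.Decidable using (does; _×-dec_)
open import Relation.Unary using (Pred; Decidable; _∈_)

------------------------------------------------------------------------
-- Real numbers, as Cauchy sequences of rationals.
--
-- Two reals are equal when each is ≤ the other; equality of the
-- representing sequences plays no role.

Cauchy : (ℕ → ℚ) → Set
Cauchy x = ∀ ε → 0ℚ ℚ.< ε →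
  ∃[ N ] (∀ m n → N ℕ.≤ m → N ℕ.≤ n → ℚ.∣ x m ℚ.- x n ∣ ℚ.< ε)

record ℝ : Set where
  constructor mkℝ
  field
    approx : ℕ → ℚ
    cauchy : Cauchy approx

open ℝ public

infix  4 _≤ℝ_
infixl 6 _+ℝ_ _⊔ℝ_

-- The limit of x is at most the limit of y. The slack ε is needed: the
-- limits may be equal although every term of x exceeds that of y.

_≤ℝ_ : ℝ → ℝ → Set
x ≤ℝ y = ∀ ε → 0ℚ ℚ.< ε →
  ∃[ N ] (∀ n → N ℕ.≤ n → approx x n ℚ.≤ approx y n ℚ.+ ε)

private

  neg-sub : ∀ p q → ℚ.- (p ℚ.- q) ≡ q ℚ.- p
  neg-sub = solve 2 (λ p q → :- (p :- q) := q :- p) refl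
    where open +-*-Solver

  ∣p-q∣<ε : ∀ p q {ε} → p ℚ.- q ℚ.< ε → q ℚ.- p ℚ.< ε → ℚ.∣ p ℚ.- q ∣ ℚ.< ε
  ∣p-q∣<ε p q h₁ h₂ with ℚ.∣p∣≡p∨∣p∣≡-p (p ℚ.- q)
  ... | inj₁ e = ℚ.<-respˡ-≡ (sym e) h₁
  ... | inj₂ e = ℚ.<-respˡ-≡ (sym (trans e (neg-sub p q))) h₂

  p≤∣p∣ : ∀ p → p ℚ.≤ ℚ.∣ p ∣
  p≤∣p∣ p with ℚ.≤-total 0ℚ p
  ... | inj₁ 0≤p = ℚ.≤-reflexive (sym (ℚ.0≤p⇒∣p∣≡p 0≤p))
  ... | inj₂ p≤0 = ℚ.≤-trans p≤0 (ℚ.0≤∣p∣ p)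

  ∣-∣-comm : ∀ p q → ℚ.∣ p ℚ.- q ∣ ≡ ℚ.∣ q ℚ.- p ∣
  ∣-∣-comm p q = trans (sym (ℚ.∣-p∣≡∣p∣ (p ℚ.- q))) (cong ℚ.∣_∣ (neg-sub p q))

  ⊔-sub : ∀ a b c d {ε} → ℚ.∣ a ℚ.- c ∣ ℚ.< ε → ℚ.∣ b ℚ.- d ∣ ℚ.< ε →
          (a ℚ.⊔ b) ℚ.- (c ℚ.⊔ d) ℚ.< ε
  ⊔-sub a b c d h₁ h₂ with ℚ.⊔-sel a b
  ... | inj₁ e rewrite e =
    ℚ.≤-<-trans (ℚ.+-monoʳ-≤ a (ℚ.neg-antimono-≤ (ℚ.p≤p⊔q c d)))
      (ℚ.≤-<-trans (p≤∣p∣ (a ℚ.- c)) h₁)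
  ... | inj₂ e rewrite e =
    ℚ.≤-<-trans (ℚ.+-monoʳ-≤ b (ℚ.neg-antimono-≤ (ℚ.p≤q⊔p c d)))
      (ℚ.≤-<-trans (p≤∣p∣ (b ℚ.- d)) h₂)

  ∣⊔-⊔∣ : ∀ a b c d {ε} → ℚ.∣ a ℚ.- c ∣ ℚ.< ε → ℚ.∣ b ℚ.- d ∣ ℚ.< ε →
          ℚ.∣ (a ℚ.⊔ b) ℚ.- (c ℚ.⊔ d) ∣ ℚ.< ε
  ∣⊔-⊔∣ a b c d h₁ h₂ = ∣p-q∣<ε (a ℚ.⊔ b) (c ℚ.⊔ d) (⊔-sub a b c d h₁ h₂)
    (⊔-sub c d a b (ℚ.<-respˡ-≡ (∣-∣-comm a c) h₁) (ℚ.<-respˡ-≡ (∣-∣-comm b d) h₂))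

  ∣+-+∣ : ∀ a b c d {ε} → ℚ.∣ a ℚ.- c ∣ ℚ.< ½ ℚ.* ε → ℚ.∣ b ℚ.- d ∣ ℚ.< ½ ℚ.* ε →
          ℚ.∣ (a ℚ.+ b) ℚ.- (c ℚ.+ d) ∣ ℚ.< ε
  ∣+-+∣ a b c d {ε} h₁ h₂ = begin-strict
    ℚ.∣ (a ℚ.+ b) ℚ.- (c ℚ.+ d) ∣         ≡⟨ cong ℚ.∣_∣ (regroup a b c d) ⟩
    ℚ.∣ (a ℚ.- c) ℚ.+ (b ℚ.- d) ∣         ≤⟨ ℚ.∣p+q∣≤∣p∣+∣q∣ (a ℚ.- c) (b ℚ.- d) ⟩
    ℚ.∣ a ℚ.- c ∣ ℚ.+ ℚ.∣ b ℚ.- d ∣       <⟨ ℚ.+-mono-< h₁ h₂ ⟩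
    ½ ℚ.* ε ℚ.+ ½ ℚ.* ε                   ≡⟨ ℚ.*-distribʳ-+ ε ½ ½ ⟨
    ℚ.1ℚ ℚ.* ε                            ≡⟨ ℚ.*-identityˡ ε ⟩
    ε                                     ∎
    where
    open ℚ.≤-Reasoning
    open +-*-Solver
    regroup : ∀ a b c d → (a ℚ.+ b) ℚ.- (c ℚ.+ d) ≡ (a ℚ.- c) ℚ.+ (b ℚ.- d)
    regroup = solve 4 (λ a b c d → (a :+ b) :- (c :+ d) := (a :- c) :+ (b :- d)) refl

  0<½ε : ∀ {ε} → 0ℚ ℚ.< ε → 0ℚ ℚ.< ½ ℚ.* ε
  0<½ε {ε} 0<ε = ℚ.<-respˡ-≡ (ℚ.*-zeroʳ ½) (ℚ.*-monoʳ-<-pos ½ 0<ε)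

0ℝ : ℝ
0ℝ = mkℝ (λ _ → 0ℚ) (λ ε 0<ε → 0 , λ _ _ _ _ → 0<ε)

_+ℝ_ : ℝ → ℝ → ℝ
mkℝ x cx +ℝ mkℝ y cy = mkℝ (λ n → x n ℚ.+ y n) λ ε 0<ε →
  let M , hx = cx (½ ℚ.* ε) (0<½ε 0<ε)
      N , hy = cy (½ ℚ.* ε) (0<½ε 0<ε)
  in M ℕ.⊔ N , λ m n l₁ l₂ → ∣+-+∣ (x m) (y m) (x n) (y n)
       (hx m n (ℕ.m⊔n≤o⇒m≤o M N l₁) (ℕ.m⊔n≤o⇒m≤o M N l₂))
       (hy m n (ℕ.m⊔n≤o⇒n≤o M N l₁) (ℕ.m⊔n≤o⇒n≤o M N l₂))

_⊔ℝ_ : ℝ → ℝ → ℝ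
mkℝ x cx ⊔ℝ mkℝ y cy = mkℝ (λ n → x n ℚ.⊔ y n) λ ε 0<ε →
  let M , hx = cx ε 0<ε
      N , hy = cy ε 0<ε
  in M ℕ.⊔ N , λ m n l₁ l₂ → ∣⊔-⊔∣ (x m) (y m) (x n) (y n)
       (hx m n (ℕ.m⊔n≤o⇒m≤o M N l₁) (ℕ.m⊔n≤o⇒m≤o M N l₂))
       (hy m n (ℕ.m⊔n≤o⇒n≤o M N l₁) (ℕ.m⊔n≤o⇒n≤o M N l₂))

sumℝ : List ℝ → ℝ
sumℝ = foldr _+ℝ_ 0ℝ

-- max of f p , f (p + 1) , … , f (p + d)

maxFrom : (p d : ℕ) → (ℕ → ℝ) → ℝ
maxFrom p zero    f = f p
maxFrom p (suc d) f = maxFrom p d f ⊔ℝ f (p ℕ.+ suc d)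

-- max of f a over p ≤ a ≤ q. Only meaningful for p ≤ q; the junk value
-- for q < p is f p.

max[_,_] : (p q : ℕ) → (ℕ → ℝ) → ℝ
max[ p , q ] f = maxFrom p (q ℕ.∸ p) f

------------------------------------------------------------------------
-- Families of subsets of [k]. The ground set [k] = {1,…,k} is Fin k, with
-- i : Fin k standing for the element toℕ i + 1.

Family : ℕ → Set₁
Family k = Pred (Subset k) 0ℓ

CrossIntersecting : ∀ {k} → ℕ → Family k → Family k → Set
CrossIntersecting t 𝓕 𝓖 = ∀ {F G} → F ∈ 𝓕 → G ∈ 𝓖 → t ℕ.≤ ∣ F ∩ G ∣

-- [ a ] as a subset of [k], for a ≤ k: the elements toℕ i + 1 ≤ a.

[_] : ∀ {k} → ℕ → Subset k
[ a ] = tabulate (λ i → does (toℕ i ℕ.<? a))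

𝓚 : ∀ k → (a s t : ℕ) → Family k
𝓚 k a s t K = ∣ K ∣ ℕ.≤ s × t ℕ.≤ ∣ K ∩ [ a ] ∣

𝓢 : ∀ k → (a s : ℕ) → Family k
𝓢 k a s S = ∣ S ∣ ℕ.≤ s × [ a ] ⊆ S

𝓚? : ∀ k a s t → Decidable (𝓚 k a s t)
𝓚? k a s t K = (∣ K ∣ ℕ.≤? s) ×-dec (t ℕ.≤? ∣ K ∩ [ a ] ∣)

𝓢? : ∀ k a s → Decidable (𝓢 k a s)
𝓢? k a s S = (∣ S ∣ ℕ.≤? s) ×-dec ([ a ] ⊆? S)

------------------------------------------------------------------------
-- Weights. A function on [0,k] is a function on Fin (suc k).

NonNegative : ∀ {k} → (Fin (suc k) → ℝ) → Set
NonNegative ω = ∀ i → 0ℝ ≤ℝ ω i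

NonIncreasing : ∀ {k} → (Fin (suc k) → ℝ) → Set
NonIncreasing ω = ∀ {i j} → i Fin.≤ j → ω j ≤ℝ ω i

-- Each subset of [k] is listed exactly once.

allSubsets : ∀ k → List (Subset k)
allSubsets zero    = Vec.[] ∷ []
allSubsets (suc k) =
  map (outside Vec.∷_) (allSubsets k) ++ map (inside Vec.∷_) (allSubsets k)

size : ∀ {k} → Subset k → Fin (suc k)
size F = fromℕ< (s≤s (∣p∣≤n F))

-- A family enters through a decision procedure for it, which is what
-- makes the sum over its members definable.

weight : ∀ {k} → (Fin (suc k) → ℝ) → {𝓕 : Family k} → Decidable 𝓕 → ℝ
weight {k} ω 𝓕? = sumℝ (map (ω ∘ size) (filter 𝓕? (allSubsets k)))

module Submission where

-- Extending the weights by 0 beyond ℓ and ℓ′ removes the size bounds from 𝓚 and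
-- 𝓢. Induct on the ground set. Suppose some A ∈ 𝓐 and some B ∈ 𝓑 avoid x.
-- Write 𝓐₀ and 𝓐₁ for the traces on the other points of the sets avoiding x
-- and of those containing x. Then (𝓐₀ ∪ 𝓐₁ , 𝓑₀) and (𝓐₀ , 𝓑₀ ∪ 𝓑₁) are again
-- cross t-intersecting and non-empty, and for the weights w i + w (i + 1) the
-- average of their total weights is at least that of (𝓐 , 𝓑), because w is
-- non-increasing. So one of the two is at least as good, and it pulls back to
-- the original ground set.
--
-- If there is no such x, then every point lies in all sets of 𝓐 or in all
-- sets of 𝓑. When the only set of 𝓑 is the full set [m], the pair is bounded
-- by 𝓚 and 𝓢 with a = m, and similarly for 𝓐. Otherwise some x lies in all of
-- 𝓐 but not in some B ∈ 𝓑, and some y lies in all of 𝓑 but not in all of 𝓐.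
-- Adding B - y + x to 𝓑 preserves the hypotheses, and y can be removed.
--
-- Real weights reduce to rational ones by perturbing their approximations.

open import Defs
open import Algebra.Bundles using (CommutativeMonoid)
open import Data.Bool.Base using (Bool; true; false; if_then_else_; _∧_; _∨_)
open import Data.Bool.Properties as Bool using (∧-zeroʳ)
open import Data.Empty using (⊥-elim)
open import Data.Fin.Base as Fin using (Fin; zero; suc; toℕ; fromℕ)
open import Data.Fin.Properties using (any?; suc-injective; toℕ-fromℕ<)
open import Data.Fin.Subset
  using (Subset; inside; outside; _⊆_; _∩_; ⊤; ∣_∣; _∉_)
  renaming (_∈_ to _∈ˢ_)
open import Data.Fin.Subset.Properties
open import Data.List.Base using (List; []; _∷_; _++_; map; filter; foldr)
open import Data.List.Properties using (map-++; map-∘)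
open import Data.Nat.Base as ℕ using (ℕ; zero; suc; _≤_; _≥_; z≤n; s≤s)
import Data.Nat.Properties as ℕ
open import Data.Product.Base using (∃-syntax; _×_; _,_; proj₁; proj₂)
open import Data.Rational.Base as ℚ using (ℚ; 0ℚ; ½)
import Data.Rational.Properties as ℚ
open import Data.Sum.Base using (_⊎_; inj₁; inj₂; [_,_]′)
open import Data.Vec.Base using ([]; _∷_; lookup; insertAt; removeAt; _[_]≔_; here; there)
open import Data.Vec.Properties
  using ([]≔-updates; []≔-minimal; lookup∘update; lookup∘update′; insertAt-removeAt; ≡-dec;
         []=⇒lookup; lookup⇒[]=)
open import Function.Base using (_∘_)
open import Relation.Binary.PropositionalEquality
  using (_≡_; _≢_; refl; sym; trans; cong; cong₂; subst; module ≡-Reasoning)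
open import Relation.Nullary.Decidable
  using (Dec; yes; no; does; ¬?; _×-dec_; decidable-stable)
open import Relation.Nullary.Negation using (¬_; contradiction)
open import Relation.Unary using (Decidable; Satisfiable; _∈_)
  renaming (_∪_ to _∪ᶠ_; _⊆_ to _⊆ᶠ_)
open import Relation.Unary.Properties using (_∪?_; _∩?_)
open import Algebra.Properties.CommutativeSemigroup
  (CommutativeMonoid.commutativeSemigroup ℚ.+-0-commutativeMonoid) using (interchange)

private
  variable
    k m : ℕ


-- Sums over all subsets and weights of families.

∑ : (Subset m → ℚ) → ℚ
∑ {zero}  f = f []
∑ {suc m} f = ∑ (f ∘ (outside ∷_)) ℚ.+ ∑ (f ∘ (inside ∷_))

∑-mono : {f g : Subset m → ℚ} → (∀ A → f A ℚ.≤ g A) → ∑ f ℚ.≤ ∑ g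
∑-mono {zero}  f≤g = f≤g []
∑-mono {suc m} f≤g =
  ℚ.+-mono-≤ (∑-mono (f≤g ∘ (outside ∷_))) (∑-mono (f≤g ∘ (inside ∷_)))

∑-cong : {f g : Subset m → ℚ} → (∀ A → f A ≡ g A) → ∑ f ≡ ∑ g
∑-cong f≗g =
  ℚ.≤-antisym (∑-mono (ℚ.≤-reflexive ∘ f≗g)) (∑-mono (ℚ.≤-reflexive ∘ sym ∘ f≗g))

∑-+ : (f g : Subset m → ℚ) → ∑ (λ A → f A ℚ.+ g A) ≡ ∑ f ℚ.+ ∑ g
∑-+ {zero}  f g = refl
∑-+ {suc m} f g = trans
  (cong₂ ℚ._+_ (∑-+ (f ∘ (outside ∷_)) (g ∘ (outside ∷_)))
               (∑-+ (f ∘ (inside ∷_)) (g ∘ (inside ∷_))))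
  (interchange (∑ (f ∘ (outside ∷_))) (∑ (g ∘ (outside ∷_)))
               (∑ (f ∘ (inside ∷_))) (∑ (g ∘ (inside ∷_))))

∑-insertAt : (x : Fin (suc m)) (f : Subset (suc m) → ℚ) →
  ∑ f ≡ ∑ (λ A → f (insertAt A x outside)) ℚ.+ ∑ (λ A → f (insertAt A x inside))
∑-insertAt         zero    f = refl
∑-insertAt {suc m} (suc x) f = trans
  (cong₂ ℚ._+_ (∑-insertAt x (f ∘ (outside ∷_))) (∑-insertAt x (f ∘ (inside ∷_))))
  (interchange (∑ (λ A → f (outside ∷ insertAt A x outside)))
               (∑ (λ A → f (outside ∷ insertAt A x inside)))
               (∑ (λ A → f (inside ∷ insertAt A x outside)))
               (∑ (λ A → f (inside ∷ insertAt A x inside))))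

restrict : {𝓐 : Family m} → Decidable 𝓐 → (Subset m → ℚ) → Subset m → ℚ
restrict 𝓐? f A = if does (𝓐? A) then f A else 0ℚ

wt : (ℕ → ℚ) → {𝓐 : Family m} → Decidable 𝓐 → ℚ
wt {m} w 𝓐? = ∑ {m} (restrict 𝓐? (w ∘ ∣_∣))

-- The weight lives on all of `ℕ`, so that `absorb` can look at size `i + 1` without a bound on `i`.
record Decreasing (w : ℕ → ℚ) : Set where
  field
    nonneg : ∀ i → 0ℚ ℚ.≤ w i
    step   : ∀ i → w (suc i) ℚ.≤ w i

open Decreasing

-- The weight of a set together with its extension by one new element.
absorb : (ℕ → ℚ) → ℕ → ℚ
absorb w i = w i ℚ.+ w (suc i)

absorb-decreasing : ∀ {w} → Decreasing w → Decreasing (absorb w)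
absorb-decreasing d .nonneg i = ℚ.+-mono-≤ (d .nonneg i) (d .nonneg (suc i))
absorb-decreasing d .step   i = ℚ.+-mono-≤ (d .step i) (d .step (suc i))

wt-mono : ∀ {w} → Decreasing w → {𝓐 𝓑 : Family m} (𝓐? : Decidable 𝓐) (𝓑? : Decidable 𝓑) →
  𝓐 ⊆ᶠ 𝓑 → wt w 𝓐? ℚ.≤ wt w 𝓑?
wt-mono {w = w} d 𝓐? 𝓑? 𝓐⊆𝓑 = ∑-mono pointwise
  where
  pointwise : ∀ A → restrict 𝓐? (w ∘ ∣_∣) A ℚ.≤ restrict 𝓑? (w ∘ ∣_∣) A
  pointwise A with 𝓐? A | 𝓑? A
  ... | yes a | yes b = ℚ.≤-refl
  ... | yes a | no ¬b = contradiction (𝓐⊆𝓑 a) ¬b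
  ... | no ¬a | yes b = d .nonneg ∣ A ∣
  ... | no ¬a | no ¬b = ℚ.≤-refl

-- Inserting a point into a set.

∣insertAt∣-outside : (A : Subset m) (x : Fin (suc m)) → ∣ insertAt A x outside ∣ ≡ ∣ A ∣
∣insertAt∣-outside A             zero    = refl
∣insertAt∣-outside (outside ∷ A) (suc x) = ∣insertAt∣-outside A x
∣insertAt∣-outside (inside ∷ A)  (suc x) = cong suc (∣insertAt∣-outside A x)

∣insertAt∣-inside : (A : Subset m) (x : Fin (suc m)) → ∣ insertAt A x inside ∣ ≡ suc ∣ A ∣
∣insertAt∣-inside A             zero    = refl
∣insertAt∣-inside (outside ∷ A) (suc x) = ∣insertAt∣-inside A x
∣insertAt∣-inside (inside ∷ A)  (suc x) = cong suc (∣insertAt∣-inside A x)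

∣A∣≤∣insertAt∣ : (A : Subset m) (x : Fin (suc m)) (b : Bool) → ∣ A ∣ ≤ ∣ insertAt A x b ∣
∣A∣≤∣insertAt∣ A x outside = ℕ.≤-reflexive (sym (∣insertAt∣-outside A x))
∣A∣≤∣insertAt∣ A x inside  = ℕ.≤-trans (ℕ.n≤1+n _) (ℕ.≤-reflexive (sym (∣insertAt∣-inside A x)))

insertAt-∩ : (A B : Subset m) (x : Fin (suc m)) (a b : Bool) →
  insertAt A x a ∩ insertAt B x b ≡ insertAt (A ∩ B) x (a ∧ b)
insertAt-∩ A       B       zero    a b = refl
insertAt-∩ (i ∷ A) (j ∷ B) (suc x) a b = cong (i ∧ j ∷_) (insertAt-∩ A B x a b)

∣insertAt-∩∣ : (A B : Subset m) (x : Fin (suc m)) (a b : Bool) → a ∧ b ≡ false →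
  ∣ insertAt A x a ∩ insertAt B x b ∣ ≡ ∣ A ∩ B ∣
∣insertAt-∩∣ A B x a b a∧b≡false = begin
  ∣ insertAt A x a ∩ insertAt B x b ∣ ≡⟨ cong ∣_∣ (insertAt-∩ A B x a b) ⟩
  ∣ insertAt (A ∩ B) x (a ∧ b) ∣      ≡⟨ cong (λ c → ∣ insertAt (A ∩ B) x c ∣) a∧b≡false ⟩
  ∣ insertAt (A ∩ B) x outside ∣      ≡⟨ ∣insertAt∣-outside (A ∩ B) x ⟩
  ∣ A ∩ B ∣                           ∎
  where open ≡-Reasoning

insertAt-⊆ : (A B : Subset m) (x : Fin (suc m)) (b : Bool) →
  A ⊆ B → insertAt A x outside ⊆ insertAt B x b
insertAt-⊆ A       B       zero    b A⊆B (there h) = there (A⊆B h)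
insertAt-⊆ (_ ∷ A) (_ ∷ B) (suc x) b A⊆B here with here ← A⊆B here = here
insertAt-⊆ (_ ∷ A) (_ ∷ B) (suc x) b A⊆B (there h) =
  there (insertAt-⊆ A B x b (drop-∷-⊆ A⊆B) h)

x∉A⇒insertAt-removeAt : (A : Subset (suc m)) (x : Fin (suc m)) → x ∉ A →
  insertAt (removeAt A x) x outside ≡ A
x∉A⇒insertAt-removeAt A x x∉A with lookup A x in eq | insertAt-removeAt A x
... | outside | e = e
... | inside  | e = contradiction (lookup⇒[]= x A eq) x∉A

-- Splitting weights at a point.

wt-insertAt : ∀ w {𝓐 : Family (suc m)} (𝓐? : Decidable 𝓐) (x : Fin (suc m)) →
  wt w 𝓐? ≡ wt w (λ A → 𝓐? (insertAt A x outside)) ℚ.+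
            wt (w ∘ suc) (λ A → 𝓐? (insertAt A x inside))
wt-insertAt w 𝓐? x = trans (∑-insertAt x (restrict 𝓐? (w ∘ ∣_∣))) (cong₂ ℚ._+_
  (∑-cong λ A → cong (λ n → if does (𝓐? (insertAt A x outside)) then w n else 0ℚ)
                     (∣insertAt∣-outside A x))
  (∑-cong λ A → cong (λ n → if does (𝓐? (insertAt A x inside)) then w n else 0ℚ)
                     (∣insertAt∣-inside A x)))

wt-absorb : ∀ w {𝓐 : Family m} (𝓐? : Decidable 𝓐) → wt (absorb w) 𝓐? ≡ wt w 𝓐? ℚ.+ wt (w ∘ suc) 𝓐?
wt-absorb w 𝓐? = trans (∑-cong pointwise) (∑-+ (restrict 𝓐? (w ∘ ∣_∣)) (restrict 𝓐? (w ∘ suc ∘ ∣_∣)))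
  where
  pointwise : ∀ A → restrict 𝓐? (absorb w ∘ ∣_∣) A ≡
                    restrict 𝓐? (w ∘ ∣_∣) A ℚ.+ restrict 𝓐? (w ∘ suc ∘ ∣_∣) A
  pointwise A with does (𝓐? A)
  ... | true  = refl
  ... | false = refl

-- Each `A` in `𝓐` has two extensions in `𝓑`, of weights `w ∣ A ∣` and `w (suc ∣ A ∣)`, whose sum is
-- what `absorb w` charges for `A`.
wt-absorb-≤ : ∀ {w} → Decreasing w → {𝓐 : Family m} {𝓑 : Family (suc m)}
  (𝓐? : Decidable 𝓐) (𝓑? : Decidable 𝓑) (x : Fin (suc m)) →
  (∀ {A} b → A ∈ 𝓐 → insertAt A x b ∈ 𝓑) → wt (absorb w) 𝓐? ℚ.≤ wt w 𝓑?
wt-absorb-≤ {w = w} d 𝓐? 𝓑? x 𝓐→𝓑 = begin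
  wt (absorb w) 𝓐?                                       ≡⟨ wt-absorb w 𝓐? ⟩
  wt w 𝓐? ℚ.+ wt (w ∘ suc) 𝓐?                            ≤⟨ ℚ.+-mono-≤
    (wt-mono d 𝓐? (λ A → 𝓑? (insertAt A x outside)) (𝓐→𝓑 outside))
    (wt-mono d∘suc 𝓐? (λ A → 𝓑? (insertAt A x inside)) (𝓐→𝓑 inside)) ⟩
  wt w (λ A → 𝓑? (insertAt A x outside)) ℚ.+
  wt (w ∘ suc) (λ A → 𝓑? (insertAt A x inside))          ≡⟨ wt-insertAt w 𝓑? x ⟨
  wt w 𝓑?                                                ∎
  where
  open ℚ.≤-Reasoning
  d∘suc : Decreasing (w ∘ suc)
  d∘suc = record { nonneg = d .nonneg ∘ suc ; step = d .step ∘ suc }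

-- The contribution of one set: `a` and `b` record membership in the two families, `p` and `q` are
-- the weights at sizes `i` and `i + 1`. Monotonicity `q ≤ p` pays for the case where only `b`
-- holds.
if-balance : ∀ a b {p q} → 0ℚ ℚ.≤ q → q ℚ.≤ p →
  let r = (if a then p else 0ℚ) ℚ.+ (if b then q else 0ℚ) in
  r ℚ.+ r ℚ.≤ (if a ∨ b then p ℚ.+ q else 0ℚ) ℚ.+ (if a then p ℚ.+ q else 0ℚ)
if-balance true  true          0≤q q≤p = ℚ.≤-refl
if-balance true  false {p} {q} 0≤q q≤p = ℚ.+-mono-≤ (ℚ.+-monoʳ-≤ p 0≤q) (ℚ.+-monoʳ-≤ p 0≤q)
if-balance false true  {p} {q} 0≤q q≤p = begin
  (0ℚ ℚ.+ q) ℚ.+ (0ℚ ℚ.+ q) ≡⟨ cong₂ ℚ._+_ (ℚ.+-identityˡ q) (ℚ.+-identityˡ q) ⟩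
  q ℚ.+ q                   ≤⟨ ℚ.+-monoˡ-≤ q q≤p ⟩
  p ℚ.+ q                   ≡⟨ ℚ.+-identityʳ (p ℚ.+ q) ⟨
  (p ℚ.+ q) ℚ.+ 0ℚ          ∎
  where open ℚ.≤-Reasoning
if-balance false false         0≤q q≤p = ℚ.≤-refl

-- A set of 𝓑 ∖ 𝓐 trades its weight w (i + 1) for (w i + w (i + 1)) / 2.
wt-balance : ∀ {w} → Decreasing w → {𝓐 𝓑 : Family m} (𝓐? : Decidable 𝓐) (𝓑? : Decidable 𝓑) →
  let v = wt w 𝓐? ℚ.+ wt (w ∘ suc) 𝓑? in
  v ℚ.+ v ℚ.≤ wt (absorb w) (𝓐? ∪? 𝓑?) ℚ.+ wt (absorb w) 𝓐?
wt-balance {m} {w} d 𝓐? 𝓑? = begin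
  (∑ f ℚ.+ ∑ g) ℚ.+ (∑ f ℚ.+ ∑ g)         ≡⟨ cong₂ ℚ._+_ (∑-+ f g) (∑-+ f g) ⟨
  ∑ (λ A → f A ℚ.+ g A) ℚ.+
  ∑ (λ A → f A ℚ.+ g A)                   ≡⟨ ∑-+ (λ A → f A ℚ.+ g A) (λ A → f A ℚ.+ g A) ⟨
  ∑ (λ A → (f A ℚ.+ g A) ℚ.+
           (f A ℚ.+ g A))                 ≤⟨ ∑-mono (λ A → if-balance (does (𝓐? A)) (does (𝓑? A))
                                                (d .nonneg (suc ∣ A ∣)) (d .step ∣ A ∣)) ⟩
  ∑ (λ A → restrict (𝓐? ∪? 𝓑?) h A ℚ.+
           restrict 𝓐? h A)               ≡⟨ ∑-+ (restrict (𝓐? ∪? 𝓑?) h) (restrict 𝓐? h) ⟩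
  wt (absorb w) (𝓐? ∪? 𝓑?) ℚ.+
  wt (absorb w) 𝓐?                        ∎
  where
  open ℚ.≤-Reasoning
  f g h : Subset m → ℚ
  f = restrict 𝓐? (w ∘ ∣_∣)
  g = restrict 𝓑? (w ∘ suc ∘ ∣_∣)
  h = absorb w ∘ ∣_∣

-- Extremal families and how they grow with the ground set.

Meets : (a t : ℕ) → Family m
Meets a t A = t ≤ ∣ A ∩ [ a ] ∣

Meets? : ∀ a t → Decidable (Meets {m} a t)
Meets? a t A = t ℕ.≤? ∣ A ∩ [ a ] ∣

Contains : (a : ℕ) → Family m
Contains a A = [ a ] ⊆ A

Contains? : ∀ a → Decidable (Contains {m} a)
Contains? a A = [ a ] ⊆? A

-- The inserted point comes last, so it lies outside every `[ a ]` with `a ≤ m`.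
[]-insertAt : ∀ {a} → a ≤ m → [_] {suc m} a ≡ insertAt [ a ] (fromℕ m) outside
[]-insertAt {zero}          z≤n       = refl
[]-insertAt {suc m} {zero}  z≤n       = cong (outside ∷_) ([]-insertAt {m} z≤n)
[]-insertAt {suc m} {suc a} (s≤s a≤m) = cong (inside ∷_) ([]-insertAt a≤m)

∈[m] : (x : Fin m) → x ∈ˢ [ m ]
∈[m] zero    = here
∈[m] (suc x) = there (∈[m] x)

-- A witness `a` stands in for the maximum over `a`. The field `a≤m` keeps `[ a ]` inside the
-- smaller ground set, so that the bound survives adding a point.
record ExtremalBound (m t s : ℕ) (w₁ w₂ : ℕ → ℚ) (v : ℚ) : Set where
  constructor extremalBound
  field
    a     : ℕ
    t≤a   : t ≤ a
    a≤s   : a ≤ s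
    a≤m   : a ≤ m
    bound : v ℚ.≤ wt w₁ (Meets? {m} a t) ℚ.+ wt w₂ (Contains? {m} a)

-- Putting a last point into a set, or leaving it out, affects neither the intersection with `[ a ]`
-- nor the containment of `[ a ]`. The point removed in the induction may be any point: only the
-- extremal families are lifted, so the new point can always be put last.
extremalBound-absorb : ∀ {t s w₁ w₂ v} → Decreasing w₁ → Decreasing w₂ →
  ExtremalBound m t s (absorb w₁) (absorb w₂) v → ExtremalBound (suc m) t s w₁ w₂ v
extremalBound-absorb {m} {t} d₁ d₂ (extremalBound a t≤a a≤s a≤m v≤) =
  extremalBound a t≤a a≤s (ℕ.m≤n⇒m≤1+n a≤m) (ℚ.≤-trans v≤ (ℚ.+-mono-≤
    (wt-absorb-≤ d₁ (Meets? a t) (Meets? a t) (fromℕ m) meets)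
    (wt-absorb-≤ d₂ (Contains? a) (Contains? a) (fromℕ m) contains)))
  where
  meets : ∀ {A} b → A ∈ Meets a t → insertAt A (fromℕ m) b ∈ Meets a t
  meets {A} b t≤ rewrite []-insertAt a≤m
    | ∣insertAt-∩∣ A [ a ] (fromℕ m) b outside (∧-zeroʳ b) = t≤
  contains : ∀ {A} b → A ∈ Contains a → insertAt A (fromℕ m) b ∈ Contains a
  contains {A} b [a]⊆A rewrite []-insertAt a≤m = insertAt-⊆ [ a ] A (fromℕ m) b [a]⊆A

-- Admissible pairs of families.

record Admissible (t ℓ ℓ′ : ℕ) (𝓐 𝓑 : Family m) : Set where
  field
    size₁     : ∀ {A} → A ∈ 𝓐 → ∣ A ∣ ≤ ℓ
    size₂     : ∀ {B} → B ∈ 𝓑 → ∣ B ∣ ≤ ℓ′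
    nonempty₁ : Satisfiable 𝓐
    nonempty₂ : Satisfiable 𝓑
    cross     : CrossIntersecting t 𝓐 𝓑

open Admissible

flip-admissible : ∀ {t ℓ ℓ′} {𝓐 𝓑 : Family m} → Admissible t ℓ ℓ′ 𝓐 𝓑 → Admissible t ℓ′ ℓ 𝓑 𝓐
flip-admissible adm .size₁     = adm .size₂
flip-admissible adm .size₂     = adm .size₁
flip-admissible adm .nonempty₁ = adm .nonempty₂
flip-admissible adm .nonempty₂ = adm .nonempty₁
flip-admissible adm .cross {F} {G} F∈ G∈ =
  subst (λ C → _ ≤ ∣ C ∣) (∩-comm G F) (adm .cross G∈ F∈)

Bounded : (m t ℓ ℓ′ : ℕ) (w₁ w₂ : ℕ → ℚ) → ℚ → Set
Bounded m t ℓ ℓ′ w₁ w₂ v = ExtremalBound m t ℓ′ w₁ w₂ v ⊎ ExtremalBound m t ℓ w₂ w₁ v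

bounded-≤ : ∀ {t ℓ ℓ′ w₁ w₂ u v} → u ℚ.≤ v → Bounded m t ℓ ℓ′ w₁ w₂ v → Bounded m t ℓ ℓ′ w₁ w₂ u
bounded-≤ u≤v (inj₁ (extremalBound a p q r v≤)) = inj₁ (extremalBound a p q r (ℚ.≤-trans u≤v v≤))
bounded-≤ u≤v (inj₂ (extremalBound a p q r v≤)) = inj₂ (extremalBound a p q r (ℚ.≤-trans u≤v v≤))

p+p≤q+r⇒p≤q⊎p≤r : ∀ {p q r} → p ℚ.+ p ℚ.≤ q ℚ.+ r → p ℚ.≤ q ⊎ p ℚ.≤ r
p+p≤q+r⇒p≤q⊎p≤r {p} {q} {r} 2p≤q+r with p ℚ.≤? q | p ℚ.≤? r
... | yes p≤q | _       = inj₁ p≤q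
... | no _    | yes p≤r = inj₂ p≤r
... | no p≰q  | no p≰r  =
  ⊥-elim (ℚ.<-irrefl refl (ℚ.≤-<-trans 2p≤q+r (ℚ.+-mono-< (ℚ.≰⇒> p≰q) (ℚ.≰⇒> p≰r))))

missing? : {𝓐 : Family m} → Decidable 𝓐 → ∀ x → Dec (∃[ A ] A ∈ 𝓐 × x ∉ A)
missing? 𝓐? x = anySubset? (λ A → 𝓐? A ×-dec ¬? (x ∈? A))

all-contain : {𝓐 : Family m} {x : Fin m} → ¬ (∃[ A ] A ∈ 𝓐 × x ∉ A) → ∀ {A} → A ∈ 𝓐 → x ∈ˢ A
all-contain {x = x} none {A} A∈𝓐 = decidable-stable (x ∈? A) (λ x∉A → none (A , A∈𝓐 , x∉A))

-- Exchanging one point of a set.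

∣∣-almost-⊆ : (x : Fin m) (A B : Subset m) → (∀ {z} → z ∈ˢ A → z ≢ x → z ∈ˢ B) → ∣ A ∣ ≤ suc ∣ B ∣
∣∣-almost-⊆ zero    (a ∷ A)       (b ∷ B) A⊆B = ℕ.≤-trans (∣∷∣≤ a) (s≤s (ℕ.≤-trans
  (p⊆q⇒∣p∣≤∣q∣ (λ z∈A → drop-there (A⊆B (there z∈A) λ ()))) (∣p∣≤∣x∷p∣ b B)))
  where
  ∣∷∣≤ : ∀ a → ∣ a ∷ A ∣ ≤ suc ∣ A ∣
  ∣∷∣≤ inside  = ℕ.≤-refl
  ∣∷∣≤ outside = ℕ.n≤1+n _
∣∣-almost-⊆ (suc x) (a ∷ A)       (b ∷ B) A⊆B
  with ∣∣-almost-⊆ x A B (λ z∈A z≢x → drop-there (A⊆B (there z∈A) (z≢x ∘ suc-injective)))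
∣∣-almost-⊆ (suc x) (outside ∷ A) (b ∷ B) A⊆B | ih = ℕ.≤-trans ih (s≤s (∣p∣≤∣x∷p∣ b B))
∣∣-almost-⊆ (suc x) (inside ∷ A)  (b ∷ B) A⊆B | ih with here ← A⊆B here (λ ()) = s≤s ih

module Exchange {B : Subset m} {x y : Fin m} (x∉B : x ∉ B) (y∈B : y ∈ˢ B) where

  private
    D : Subset m
    D = B [ y ]≔ outside

  exchange : Subset m
  exchange = D [ x ]≔ inside

  private
    y≢x : y ≢ x
    y≢x refl = x∉B y∈B

    y∉D : y ∉ D
    y∉D y∈D with () ← trans (sym ([]=⇒lookup y∈D)) (lookup∘update y B outside)

    D⊆B : D ⊆ B
    D⊆B {z} z∈D = lookup⇒[]= z B (trans (sym (lookup∘update′ z≢y B outside)) ([]=⇒lookup z∈D))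
      where
      z≢y : z ≢ y
      z≢y refl = y∉D z∈D

    D⊆exchange : D ⊆ exchange
    D⊆exchange {z} z∈D = []≔-minimal D z x (λ { refl → x∉B (D⊆B z∈D) }) z∈D

    exchange⊆D : ∀ {z} → z ∈ˢ exchange → z ≢ x → z ∈ˢ D
    exchange⊆D {z} z∈ z≢x =
      lookup⇒[]= z D (trans (sym (lookup∘update′ z≢x D inside)) ([]=⇒lookup z∈))

  y∉exchange : y ∉ exchange
  y∉exchange y∈ = y∉D (exchange⊆D y∈ y≢x)

  -- `D` is a proper subset of `B`, as it lacks `y`, and the exchange adds only `x` to it.
  ∣exchange∣ : ∣ exchange ∣ ≤ ∣ B ∣
  ∣exchange∣ = ℕ.≤-trans (∣∣-almost-⊆ x exchange D exchange⊆D)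
    (p⊂q⇒∣p∣<∣q∣ (D⊆B , y , y∈B , y∉D))

  -- Dropping `y` costs the intersection at most one element; adding `x`, which lies in `A` but not
  -- in `D`, gains one back.
  ∣∩exchange∣ : ∀ {A} → x ∈ˢ A → ∣ A ∩ B ∣ ≤ ∣ A ∩ exchange ∣
  ∣∩exchange∣ {A} x∈A = ℕ.≤-trans
    (∣∣-almost-⊆ y (A ∩ B) (A ∩ D) λ {z} z∈A∩B z≢y →
      let z∈A , z∈B = x∈p∩q⁻ A B z∈A∩B in
      x∈p∩q⁺ (z∈A , []≔-minimal B z y z≢y z∈B))
    (p⊂q⇒∣p∣<∣q∣
      ( (λ z∈A∩D → let z∈A , z∈D = x∈p∩q⁻ A D z∈A∩D in x∈p∩q⁺ (z∈A , D⊆exchange z∈D))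
      , x , x∈p∩q⁺ (x∈A , []≔-updates D x)
      , x∉B ∘ D⊆B ∘ proj₂ ∘ x∈p∩q⁻ A D))

open Exchange

-- The choice `a = m` is allowed: `m` is the size of `B₀`, so `m ≤ ℓ′`, and `A ∩ B₀` has at least
-- `t` elements, so `t ≤ m`. An empty ground set always falls under this case, which makes it the
-- base of the induction.
bound-full : ∀ {t ℓ ℓ′ w₁ w₂} → Decreasing w₁ → Decreasing w₂ →
  {𝓐 𝓑 : Family m} (𝓐? : Decidable 𝓐) (𝓑? : Decidable 𝓑) → Admissible t ℓ ℓ′ 𝓐 𝓑 →
  (∀ x {B} → B ∈ 𝓑 → x ∈ˢ B) → ExtremalBound m t ℓ′ w₁ w₂ (wt w₁ 𝓐? ℚ.+ wt w₂ 𝓑?)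
bound-full {m} {t} {ℓ′ = ℓ′} d₁ d₂ {𝓐} {𝓑} 𝓐? 𝓑? adm full =
  extremalBound m t≤m m≤ℓ′ ℕ.≤-refl (ℚ.+-mono-≤
    (wt-mono d₁ 𝓐? (Meets? m t) meets) (wt-mono d₂ 𝓑? (Contains? m) (λ B∈𝓑 _ → full _ B∈𝓑)))
  where
  B₀ = proj₁ (adm .nonempty₂)
  B₀∈𝓑 = proj₂ (adm .nonempty₂)
  meets : 𝓐 ⊆ᶠ Meets m t
  meets {A} A∈𝓐 = ℕ.≤-trans (adm .cross A∈𝓐 B₀∈𝓑) (p⊆q⇒∣p∣≤∣q∣
    (λ x∈ → x∈p∩q⁺ (proj₁ (x∈p∩q⁻ A B₀ x∈) , ∈[m] _)))
  t≤m : t ≤ m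
  t≤m = ℕ.≤-trans (adm .cross (proj₂ (adm .nonempty₁)) B₀∈𝓑) (∣p∣≤n (proj₁ (adm .nonempty₁) ∩ B₀))
  m≤ℓ′ : m ≤ ℓ′
  m≤ℓ′ = ℕ.≤-trans (ℕ.≤-reflexive (sym (∣⊤∣≡n m)))
    (ℕ.≤-trans (p⊆q⇒∣p∣≤∣q∣ {p = ⊤} (λ _ → full _ B₀∈𝓑)) (adm .size₂ B₀∈𝓑))

-- Induction on the ground set.

-- Weights and families are quantified inside, since the induction replaces the weights by their
-- absorbed forms and the families by sections and projections.
Claim : ℕ → Set₁
Claim m = ∀ {t ℓ ℓ′ w₁ w₂} → Decreasing w₁ → Decreasing w₂ →
  {𝓐 𝓑 : Family m} (𝓐? : Decidable 𝓐) (𝓑? : Decidable 𝓑) → Admissible t ℓ ℓ′ 𝓐 𝓑 →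
  Bounded m t ℓ ℓ′ w₁ w₂ (wt w₁ 𝓐? ℚ.+ wt w₂ 𝓑?)

section : Fin (suc m) → Bool → Family (suc m) → Family m
section x b 𝓐 A = insertAt A x b ∈ 𝓐

section? : ∀ x b {𝓐 : Family (suc m)} → Decidable 𝓐 → Decidable (section x b 𝓐)
section? x b 𝓐? A = 𝓐? (insertAt A x b)

projection : Fin (suc m) → Family (suc m) → Family m
projection x 𝓐 = section x outside 𝓐 ∪ᶠ section x inside 𝓐

projection? : ∀ x {𝓐 : Family (suc m)} → Decidable 𝓐 → Decidable (projection x 𝓐)
projection? x 𝓐? = section? x outside 𝓐? ∪? section? x inside 𝓐?

-- The sets kept from `𝓑` avoid `x`, so `x` never counts in an intersection and deleting it from the
-- sets of `𝓐` costs nothing. The set `B₀` keeps the second family non-empty.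
project-admissible : ∀ {t ℓ ℓ′} {𝓐 𝓑 : Family (suc m)} (x : Fin (suc m)) →
  Admissible t ℓ ℓ′ 𝓐 𝓑 → (∃[ B ] B ∈ 𝓑 × x ∉ B) →
  Admissible t ℓ ℓ′ (projection x 𝓐) (section x outside 𝓑)
project-admissible {𝓐 = 𝓐} {𝓑} x adm (B₀ , B₀∈𝓑 , x∉B₀) = record
  { size₁     = λ { {A} (inj₁ A∈) → ℕ.≤-trans (∣A∣≤∣insertAt∣ A x outside) (adm .size₁ A∈)
                  ; {A} (inj₂ A∈) → ℕ.≤-trans (∣A∣≤∣insertAt∣ A x inside) (adm .size₁ A∈) }
  ; size₂     = λ {B} B∈ → ℕ.≤-trans (∣A∣≤∣insertAt∣ B x outside) (adm .size₂ B∈)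
  ; nonempty₁ = projected (adm .nonempty₁)
  ; nonempty₂ = removeAt B₀ x , subst (_∈ 𝓑) (sym (x∉A⇒insertAt-removeAt B₀ x x∉B₀)) B₀∈𝓑
  ; cross     = λ { {A} {B} (inj₁ A∈) B∈ → cross′ A B outside (adm .cross A∈ B∈)
                  ; {A} {B} (inj₂ A∈) B∈ → cross′ A B inside (adm .cross A∈ B∈) }
  }
  where
  projected : Satisfiable 𝓐 → Satisfiable (projection x 𝓐)
  projected (A , A∈𝓐) with lookup A x | insertAt-removeAt A x
  ... | outside | e = removeAt A x , inj₁ (subst (_∈ 𝓐) (sym e) A∈𝓐)
  ... | inside  | e = removeAt A x , inj₂ (subst (_∈ 𝓐) (sym e) A∈𝓐)
  cross′ : ∀ {t} A B b → t ≤ ∣ insertAt A x b ∩ insertAt B x outside ∣ → t ≤ ∣ A ∩ B ∣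
  cross′ A B b = subst (_ ≤_) (∣insertAt-∩∣ A B x b outside (∧-zeroʳ b))

claim-pivot : Claim m → ∀ {t ℓ ℓ′ w₁ w₂} → Decreasing w₁ → Decreasing w₂ →
  {𝓐 𝓑 : Family (suc m)} (𝓐? : Decidable 𝓐) (𝓑? : Decidable 𝓑) → Admissible t ℓ ℓ′ 𝓐 𝓑 →
  (x : Fin (suc m)) → (∃[ A ] A ∈ 𝓐 × x ∉ A) → (∃[ B ] B ∈ 𝓑 × x ∉ B) →
  Bounded (suc m) t ℓ ℓ′ w₁ w₂ (wt w₁ 𝓐? ℚ.+ wt w₂ 𝓑?)
claim-pivot {m} ih {w₁ = w₁} {w₂} d₁ d₂ 𝓐? 𝓑? adm x missA missB =
  -- The first pair projects `𝓐` and keeps the part of `𝓑` avoiding `x`; the second does the same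
  -- with the roles exchanged, hence the two flips.
  [ (λ v≤p → bounded-≤ v≤p (lift (ih d₁′ d₂′ 𝓐⁺? 𝓑₀? (project-admissible x adm missB))))
  , (λ v≤q → bounded-≤ v≤q (lift (ih d₁′ d₂′ 𝓐₀? 𝓑⁺?
      (flip-admissible (project-admissible x (flip-admissible adm) missA)))))
  ]′ (p+p≤q+r⇒p≤q⊎p≤r doubled)
  where
  d₁′ = absorb-decreasing d₁
  d₂′ = absorb-decreasing d₂
  𝓐₀? = section? x outside 𝓐?
  𝓐⁺? = projection? x 𝓐?
  𝓑₀? = section? x outside 𝓑?
  𝓑⁺? = projection? x 𝓑?
  lift : ∀ {t ℓ ℓ′ v} → Bounded m t ℓ ℓ′ (absorb w₁) (absorb w₂) v → Bounded (suc m) t ℓ ℓ′ w₁ w₂ v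
  lift = [ inj₁ ∘ extremalBound-absorb d₁ d₂ , inj₂ ∘ extremalBound-absorb d₂ d₁ ]′
  α = wt w₁ 𝓐?
  β = wt w₂ 𝓑?
  α₀ = wt (absorb w₁) 𝓐₀?
  α⁺ = wt (absorb w₁) 𝓐⁺?
  β₀ = wt (absorb w₂) 𝓑₀?
  β⁺ = wt (absorb w₂) 𝓑⁺?
  double : ∀ {w} → Decreasing w → {𝓒 : Family (suc m)} (𝓒? : Decidable 𝓒) →
    wt w 𝓒? ℚ.+ wt w 𝓒? ℚ.≤ wt (absorb w) (projection? x 𝓒?) ℚ.+ wt (absorb w) (section? x outside 𝓒?)
  double {w} d 𝓒? rewrite wt-insertAt w 𝓒? x = wt-balance d
    (section? x outside 𝓒?) (section? x inside 𝓒?)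
  doubled : (α ℚ.+ β) ℚ.+ (α ℚ.+ β) ℚ.≤ (α⁺ ℚ.+ β₀) ℚ.+ (α₀ ℚ.+ β⁺)
  doubled = begin
    (α ℚ.+ β) ℚ.+ (α ℚ.+ β)       ≡⟨ interchange α β α β ⟩
    (α ℚ.+ α) ℚ.+ (β ℚ.+ β)       ≤⟨ ℚ.+-mono-≤ (double d₁ 𝓐?) (double d₂ 𝓑?) ⟩
    (α⁺ ℚ.+ α₀) ℚ.+ (β⁺ ℚ.+ β₀)   ≡⟨ cong ((α⁺ ℚ.+ α₀) ℚ.+_) (ℚ.+-comm β⁺ β₀) ⟩
    (α⁺ ℚ.+ α₀) ℚ.+ (β₀ ℚ.+ β⁺)   ≡⟨ interchange α⁺ α₀ β₀ β⁺ ⟩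
    (α⁺ ℚ.+ β₀) ℚ.+ (α₀ ℚ.+ β⁺)   ∎
    where open ℚ.≤-Reasoning

-- The new set is no larger than `B`, and since every `A` in `𝓐` contains `x`, it meets `A` in at
-- least as many points as `B` does.
exchange-admissible : ∀ {t ℓ ℓ′} {𝓐 𝓑 : Family m} {x y B} → Admissible t ℓ ℓ′ 𝓐 𝓑 →
  (∀ {A} → A ∈ 𝓐 → x ∈ˢ A) → B ∈ 𝓑 → (x∉B : x ∉ B) (y∈B : y ∈ˢ B) →
  Admissible t ℓ ℓ′ 𝓐 (𝓑 ∪ᶠ (_≡ exchange x∉B y∈B))
exchange-admissible {x = x} {y} {B} adm x∈all B∈𝓑 x∉B y∈B = record
  { size₁     = adm .size₁
  ; size₂     = λ { (inj₁ B∈) → adm .size₂ B∈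
                  ; (inj₂ refl) → ℕ.≤-trans (∣exchange∣ x∉B y∈B) (adm .size₂ B∈𝓑) }
  ; nonempty₁ = adm .nonempty₁
  ; nonempty₂ = B , inj₁ B∈𝓑
  ; cross     = λ { A∈ (inj₁ B∈) → adm .cross A∈ B∈
                  ; A∈ (inj₂ refl) → ℕ.≤-trans (adm .cross A∈ B∈𝓑) (∣∩exchange∣ x∉B y∈B (x∈all A∈)) }
  }

claim : ∀ m → Claim m
-- The only descent of the recursion: the point `x` makes the ground set non-empty, and `claim` is
-- invoked with one point fewer.
claim-missing : ∀ {t ℓ ℓ′ w₁ w₂} → Decreasing w₁ → Decreasing w₂ →
  {𝓐 𝓑 : Family m} (𝓐? : Decidable 𝓐) (𝓑? : Decidable 𝓑) → Admissible t ℓ ℓ′ 𝓐 𝓑 →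
  (x : Fin m) → (∃[ A ] A ∈ 𝓐 × x ∉ A) → (∃[ B ] B ∈ 𝓑 × x ∉ B) →
  Bounded m t ℓ ℓ′ w₁ w₂ (wt w₁ 𝓐? ℚ.+ wt w₂ 𝓑?)

claim m {w₁ = w₁} {w₂} d₁ d₂ 𝓐? 𝓑? adm with any? (missing? 𝓑?)
... | no none = inj₁ (bound-full d₁ d₂ 𝓐? 𝓑? adm (λ x → all-contain (λ e → none (x , e))))
... | yes (x , missB@(B , B∈𝓑 , x∉B)) with missing? 𝓐? x
...   | yes missA = claim-missing d₁ d₂ 𝓐? 𝓑? adm x missA missB
...   | no none-x with any? (missing? 𝓐?)
...     | no none = inj₂ (subst (ExtremalBound m _ _ _ _) (ℚ.+-comm (wt w₂ 𝓑?) (wt w₁ 𝓐?))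
  (bound-full d₂ d₁ 𝓑? 𝓐? (flip-admissible adm) (λ y → all-contain (λ e → none (y , e)))))
...     | yes (y , missA) with missing? 𝓑? y
...       | yes missB′ = claim-missing d₁ d₂ 𝓐? 𝓑? adm y missA missB′
-- Here `x` lies in all of `𝓐` and `y` in all of `𝓑`. Adding `C` to `𝓑` does not lower the weight,
-- and afterwards each family has a set missing `y`, so one exchange is enough.
...       | no none-y = bounded-≤ (ℚ.+-monoʳ-≤ (wt w₁ 𝓐?) (wt-mono d₂ 𝓑? 𝓑⁺? inj₁))
  (claim-missing d₁ d₂ 𝓐? 𝓑⁺?
    (exchange-admissible adm (all-contain none-x) B∈𝓑 x∉B y∈B) y missA
    (C , inj₂ refl , y∉exchange x∉B y∈B))
  where
  y∈B = all-contain none-y B∈𝓑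
  C = exchange x∉B y∈B
  𝓑⁺? = 𝓑? ∪? (λ D → ≡-dec Bool._≟_ D C)

claim-missing {suc m} d₁ d₂ 𝓐? 𝓑? adm = claim-pivot (claim m) d₁ d₂ 𝓐? 𝓑? adm

-- Real weights and maxima at a fixed index.

sumℚ : List ℚ → ℚ
sumℚ = foldr ℚ._+_ 0ℚ

approx-sumℝ : (n : ℕ) (f : Subset m → ℝ) {𝓐 : Family m} (𝓐? : Decidable 𝓐) (As : List (Subset m)) →
  approx (sumℝ (map f (filter 𝓐? As))) n ≡ sumℚ (map (restrict 𝓐? (λ A → approx (f A) n)) As)
approx-sumℝ n f 𝓐? []       = refl
approx-sumℝ n f 𝓐? (A ∷ As) with does (𝓐? A)
... | true  = cong (approx (f A) n ℚ.+_) (approx-sumℝ n f 𝓐? As)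
... | false = trans (approx-sumℝ n f 𝓐? As) (sym (ℚ.+-identityˡ _))

sumℚ-++ : ∀ ps qs → sumℚ (ps ++ qs) ≡ sumℚ ps ℚ.+ sumℚ qs
sumℚ-++ []       qs = sym (ℚ.+-identityˡ _)
sumℚ-++ (p ∷ ps) qs = trans (cong (p ℚ.+_) (sumℚ-++ ps qs)) (sym (ℚ.+-assoc p (sumℚ ps) (sumℚ qs)))

sumℚ-allSubsets : ∀ k (f : Subset k → ℚ) → sumℚ (map f (allSubsets k)) ≡ ∑ f
sumℚ-allSubsets zero    f = ℚ.+-identityʳ (f [])
sumℚ-allSubsets (suc k) f = begin
  sumℚ (map f (map (outside ∷_) As ++ map (inside ∷_) As))
    ≡⟨ cong sumℚ (map-++ f (map (outside ∷_) As) (map (inside ∷_) As)) ⟩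
  sumℚ (map f (map (outside ∷_) As) ++ map f (map (inside ∷_) As))
    ≡⟨ sumℚ-++ (map f (map (outside ∷_) As)) (map f (map (inside ∷_) As)) ⟩
  sumℚ (map f (map (outside ∷_) As)) ℚ.+ sumℚ (map f (map (inside ∷_) As))
    ≡⟨ cong₂ (λ ps qs → sumℚ ps ℚ.+ sumℚ qs) (map-∘ As) (map-∘ As) ⟨
  sumℚ (map (f ∘ (outside ∷_)) As) ℚ.+ sumℚ (map (f ∘ (inside ∷_)) As)
    ≡⟨ cong₂ ℚ._+_ (sumℚ-allSubsets k (f ∘ (outside ∷_))) (sumℚ-allSubsets k (f ∘ (inside ∷_))) ⟩
  ∑ f ∎
  where
  open ≡-Reasoning
  As = allSubsets k

sumAt : ℕ → (Fin (suc k) → ℝ) → {𝓐 : Family k} → Decidable 𝓐 → ℚ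
sumAt n ω 𝓐? = ∑ (restrict 𝓐? (λ A → approx (ω (size A)) n))

approx-weight : ∀ n (ω : Fin (suc k) → ℝ) {𝓐 : Family k} (𝓐? : Decidable 𝓐) →
  approx (weight ω 𝓐?) n ≡ sumAt n ω 𝓐?
approx-weight {k} n ω 𝓐? =
  trans (approx-sumℝ n (ω ∘ size) 𝓐? (allSubsets k)) (sumℚ-allSubsets k _)

maxFrom-upper : ∀ n p d f {a} → p ≤ a → a ≤ p ℕ.+ d → approx (f a) n ℚ.≤ approx (maxFrom p d f) n
maxFrom-upper n p zero f p≤a a≤p+0
  rewrite ℕ.≤-antisym (subst (_ ≤_) (ℕ.+-identityʳ p) a≤p+0) p≤a = ℚ.≤-refl
maxFrom-upper n p (suc d) f {a} p≤a a≤ with ℕ.m≤n⇒m<n∨m≡n a≤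
... | inj₂ refl = ℚ.p≤q⊔p (approx (maxFrom p d f) n) _
... | inj₁ a<   = ℚ.≤-trans
  (maxFrom-upper n p d f p≤a (ℕ.s≤s⁻¹ (subst (a ℕ.<_) (ℕ.+-suc p d) a<)))
  (ℚ.p≤p⊔q (approx (maxFrom p d f) n) _)

max-upper : ∀ n {p q a} f → p ≤ a → a ≤ q → approx (f a) n ℚ.≤ approx (max[ p , q ] f) n
max-upper n {p} {q} f p≤a a≤q = maxFrom-upper n p (q ℕ.∸ p) f p≤a
  -- From `p ≤ a ≤ q` it follows that `p + (q ∸ p)` is `q`, so the junk value for `q < p` does not
  -- arise.
  (subst (_ ≤_) (sym (ℕ.m+[n∸m]≡n (ℕ.≤-trans p≤a a≤q))) a≤q)

-- Error terms and perturbed weights.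

-- This is `2 ^ m` times `q`. As a sum over subsets it is directly the accumulated error when each
-- subset contributes `q`, and its doubling from `m` to `suc m` is definitional.
total : ℕ → ℚ → ℚ
total m q = ∑ {m} (λ _ → q)

module _ {q : ℚ} (0≤q : 0ℚ ℚ.≤ q) where

  total-nonneg : ∀ m → 0ℚ ℚ.≤ total m q
  total-nonneg zero    = 0≤q
  total-nonneg (suc m) = ℚ.+-mono-≤ (total-nonneg m) (total-nonneg m)

  total-suc : ∀ m → total m q ℚ.≤ total (suc m) q
  total-suc m = ℚ.≤-trans (ℚ.≤-reflexive (sym (ℚ.+-identityʳ (total m q))))
    (ℚ.+-monoʳ-≤ (total m q) (total-nonneg m))

  total-mono : ∀ {m n} → m ≤ n → total m q ℚ.≤ total n q
  total-mono {m} m≤n = go (ℕ.≤⇒≤′ m≤n)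
    where
    go : ∀ {n} → m ℕ.≤′ n → total m q ℚ.≤ total n q
    go (ℕ.≤′-reflexive refl) = ℚ.≤-refl
    go (ℕ.≤′-step {n} m≤′n)  = ℚ.≤-trans (go m≤′n) (total-suc n)

½ε+½ε≡ε : ∀ ε → ½ ℚ.* ε ℚ.+ ½ ℚ.* ε ≡ ε
½ε+½ε≡ε ε = trans (sym (ℚ.*-distribʳ-+ ε ½ ½)) (ℚ.*-identityˡ ε)

0<½ε : ∀ {ε} → 0ℚ ℚ.< ε → 0ℚ ℚ.< ½ ℚ.* ε
0<½ε 0<ε = ℚ.<-respˡ-≡ (ℚ.*-zeroʳ ½) (ℚ.*-monoʳ-<-pos ½ 0<ε)

total-small : ∀ m {ε} → 0ℚ ℚ.< ε → ∃[ δ ] 0ℚ ℚ.< δ × total m δ ℚ.≤ ε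
total-small zero    {ε} 0<ε = ε , 0<ε , ℚ.≤-refl
total-small (suc m) {ε} 0<ε =
  let δ , 0<δ , total≤ = total-small m (0<½ε 0<ε) in
  δ , 0<δ , ℚ.≤-trans (ℚ.+-mono-≤ total≤ total≤) (ℚ.≤-reflexive (½ε+½ε≡ε ε))

-- At a fixed index the approximations of a non-increasing weight are
-- non-increasing only up to an error δ. Adding 2 ^ (k + 1 - i) · δ, which is
-- total (k + 1 - i) δ, repairs this, since consecutive corrections differ by
-- at least δ.
module Perturb (δ : ℚ) (0≤δ : 0ℚ ℚ.≤ δ) (ℓ : ℕ) (ℓ≤k : ℓ ≤ k) (u : Fin (suc k) → ℚ) where

  index : ∀ {i} → i ≤ ℓ → Fin (suc k)
  index i≤ℓ = Fin.fromℕ< (s≤s (ℕ.≤-trans i≤ℓ ℓ≤k))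

  -- The decision is an argument so that proofs can match on it.
  value : ∀ i → Dec (i ≤ ℓ) → ℚ
  value i (yes i≤ℓ) = u (index i≤ℓ) ℚ.+ total (suc k ℕ.∸ i) δ
  value i (no  _)   = 0ℚ

  perturb : ℕ → ℚ
  perturb i = value i (i ℕ.≤? ℓ)

  perturb-decreasing : (∀ i → 0ℚ ℚ.≤ u i ℚ.+ δ) → (∀ {i j} → i Fin.≤ j → u j ℚ.≤ u i ℚ.+ δ) →
    Decreasing perturb
  perturb-decreasing u≥-δ u-decr = record
    { nonneg = λ i → value-nonneg i (i ℕ.≤? ℓ) ; step = perturb-step }
    where
    open ℚ.≤-Reasoning
    value-nonneg : ∀ i i≤?ℓ → 0ℚ ℚ.≤ value i i≤?ℓ
    -- `total 0 δ` is `δ`, so the correction makes up for a value as low as `- δ`.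
    value-nonneg i (yes i≤ℓ) = ℚ.≤-trans (u≥-δ (index i≤ℓ))
      (ℚ.+-monoʳ-≤ (u (index i≤ℓ)) (total-mono 0≤δ {0} {suc k ℕ.∸ i} z≤n))
    value-nonneg i (no  _) = ℚ.≤-refl
    perturb-step : ∀ i → perturb (suc i) ℚ.≤ perturb i
    perturb-step i with suc i ℕ.≤? ℓ | i ℕ.≤? ℓ
    ... | no _    | i≤?ℓ   = value-nonneg i i≤?ℓ
    ... | yes i<ℓ | no i≰ℓ = contradiction (ℕ.<⇒≤ i<ℓ) i≰ℓ
    ... | yes i<ℓ | yes i≤ℓ = begin
      u (index i<ℓ) ℚ.+ total (k ℕ.∸ i) δ
        ≤⟨ ℚ.+-monoˡ-≤ (total (k ℕ.∸ i) δ) (u-decr i≤1+i) ⟩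
      (u (index i≤ℓ) ℚ.+ δ) ℚ.+ total (k ℕ.∸ i) δ
        ≡⟨ ℚ.+-assoc (u (index i≤ℓ)) δ (total (k ℕ.∸ i) δ) ⟩
      u (index i≤ℓ) ℚ.+ (δ ℚ.+ total (k ℕ.∸ i) δ)
        -- The doubled correction is two copies of `total (k ∸ i) δ`, and one of them covers the
        -- error `δ`.
        ≤⟨ ℚ.+-monoʳ-≤ (u (index i≤ℓ))
             (ℚ.+-monoˡ-≤ (total (k ℕ.∸ i) δ) (total-mono 0≤δ {0} {k ℕ.∸ i} z≤n)) ⟩
      u (index i≤ℓ) ℚ.+ total (suc (k ℕ.∸ i)) δ
        ≡⟨ cong (λ j → u (index i≤ℓ) ℚ.+ total j δ) (ℕ.+-∸-assoc 1 (ℕ.≤-trans i≤ℓ ℓ≤k)) ⟨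
      u (index i≤ℓ) ℚ.+ total (suc k ℕ.∸ i) δ
        ∎
      where
      i≤1+i : index i≤ℓ Fin.≤ index i<ℓ
      i≤1+i rewrite toℕ-fromℕ< (s≤s (ℕ.≤-trans i≤ℓ ℓ≤k))
                  | toℕ-fromℕ< (s≤s (ℕ.≤-trans i<ℓ ℓ≤k)) = ℕ.n≤1+n i

  -- Corrections are non-negative, and the cut-off beyond `ℓ` touches no member of `𝓐`.
  wt-perturb-lower : {𝓐 : Family k} (𝓐? : Decidable 𝓐) → (∀ {A} → A ∈ 𝓐 → ∣ A ∣ ≤ ℓ) →
    ∑ (restrict 𝓐? (u ∘ size)) ℚ.≤ wt perturb 𝓐?
  wt-perturb-lower 𝓐? 𝓐-size = ∑-mono pointwise
    where
    pointwise : ∀ A → restrict 𝓐? (u ∘ size) A ℚ.≤ restrict 𝓐? (perturb ∘ ∣_∣) A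
    pointwise A with 𝓐? A | ∣ A ∣ ℕ.≤? ℓ
    ... | no _    | _      = ℚ.≤-refl
    ... | yes A∈𝓐 | no ≰ℓ = contradiction (𝓐-size A∈𝓐) ≰ℓ
    ... | yes _   | yes _  = ℚ.≤-trans (ℚ.≤-reflexive (sym (ℚ.+-identityʳ _)))
      (ℚ.+-monoʳ-≤ (u (size A)) (total-nonneg 0≤δ (suc k ℕ.∸ ∣ A ∣)))

  -- Each of the `2 ^ k` subsets carries a correction of at most `c`, and sets larger than `ℓ` weigh
  -- 0. Applied to `Meets` and `Contains`, the restriction to size at most `ℓ` gives back `𝓚` and
  -- `𝓢`.
  wt-perturb-upper : {𝓐 : Family k} (𝓐? : Decidable 𝓐) → ∀ {c} → total (suc k) δ ℚ.≤ c →
    wt perturb 𝓐? ℚ.≤ ∑ (restrict ((λ A → ∣ A ∣ ℕ.≤? ℓ) ∩? 𝓐?) (u ∘ size)) ℚ.+ total k c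
  wt-perturb-upper {𝓐} 𝓐? {c} total≤c = ℚ.≤-trans (∑-mono (λ A → value-≤ A (∣ A ∣ ℕ.≤? ℓ) (𝓐? A)))
    (ℚ.≤-reflexive (∑-+ (restrict 𝓐ℓ? (u ∘ size)) (λ _ → c)))
    where
    𝓐ℓ? : Decidable (λ A → ∣ A ∣ ≤ ℓ × 𝓐 A)
    𝓐ℓ? = (λ A → ∣ A ∣ ℕ.≤? ℓ) ∩? 𝓐?
    0≤c : 0ℚ ℚ.≤ 0ℚ ℚ.+ c
    0≤c = ℚ.≤-trans (ℚ.≤-trans (total-nonneg 0≤δ (suc k)) total≤c)
      (ℚ.≤-reflexive (sym (ℚ.+-identityˡ c)))
    value-≤ : ∀ A (d : Dec (∣ A ∣ ≤ ℓ)) (a : Dec (𝓐 A)) →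
      (if does a then value ∣ A ∣ d else 0ℚ) ℚ.≤ (if does d ∧ does a then u (size A) else 0ℚ) ℚ.+ c
    value-≤ A (no _)  (no _)  = 0≤c
    value-≤ A (yes _) (no _)  = 0≤c
    value-≤ A (no _)  (yes _) = 0≤c
    value-≤ A (yes _) (yes _) = ℚ.+-monoʳ-≤ (u (size A))
      (ℚ.≤-trans (total-mono 0≤δ (ℕ.m∸n≤m (suc k) ∣ A ∣)) total≤c)

-- Properties holding from some index on.

Eventually : (ℕ → Set) → Set
Eventually P = ∃[ N ] (∀ n → N ≤ n → P n)

eventually-map : {P Q : ℕ → Set} → (∀ {n} → P n → Q n) → Eventually P → Eventually Q
eventually-map P→Q (N , p) = N , λ n N≤n → P→Q (p n N≤n)

eventually-zip : {P Q R : ℕ → Set} → (∀ {n} → P n → Q n → R n) →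
  Eventually P → Eventually Q → Eventually R
eventually-zip f (M , p) (N , q) = M ℕ.⊔ N , λ n M⊔N≤n →
  f (p n (ℕ.m⊔n≤o⇒m≤o M N M⊔N≤n)) (q n (ℕ.m⊔n≤o⇒n≤o M N M⊔N≤n))

eventually-all : {P : Fin m → ℕ → Set} → (∀ i → Eventually (P i)) → Eventually (λ n → ∀ i → P i n)
eventually-all {zero}  ev = 0 , λ _ _ ()
eventually-all {suc m} ev = eventually-zip
  (λ { p ps zero → p ; p ps (suc i) → ps i }) (ev zero) (eventually-all (ev ∘ suc))

-- Only finitely many sizes and pairs of sizes are compared, so one index serves for all of them.
eventually-decreasing : (ω : Fin (suc k) → ℝ) → NonNegative ω → NonIncreasing ω → ∀ {δ} → 0ℚ ℚ.< δ →
  ∀ {ℓ} (ℓ≤k : ℓ ≤ k) (0≤δ : 0ℚ ℚ.≤ δ) →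
  Eventually (λ n → Decreasing (Perturb.perturb δ 0≤δ ℓ ℓ≤k (λ i → approx (ω i) n)))
eventually-decreasing ω ω≥0 ω-decr {δ} 0<δ {ℓ} ℓ≤k 0≤δ = eventually-zip
  (λ {n} → Perturb.perturb-decreasing δ 0≤δ ℓ ℓ≤k (λ i → approx (ω i) n))
  (eventually-all (λ i → ω≥0 i δ 0<δ))
  (eventually-map (λ f {i} {j} → f i j) (eventually-all (λ i → eventually-all (λ j → decr i j))))
  where
  decr : ∀ i j → Eventually (λ n → i Fin.≤ j → approx (ω j) n ℚ.≤ approx (ω i) n ℚ.+ δ)
  decr i j with toℕ i ℕ.≤? toℕ j
  ... | yes i≤j = eventually-map (λ h _ → h) (ω-decr i≤j δ 0<δ)
  ... | no  i≰j = 0 , λ _ _ i≤j → contradiction i≤j i≰j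

-- From rational bounds at each late index to the bound on reals.

approx-weights : ∀ n (ω₁ ω₂ : Fin (suc k) → ℝ) {𝓐 𝓑 : Family k} (𝓐? : Decidable 𝓐) (𝓑? : Decidable 𝓑) →
  approx (weight ω₁ 𝓐? +ℝ weight ω₂ 𝓑?) n ≡
  sumAt n ω₁ 𝓐? ℚ.+ sumAt n ω₂ 𝓑?
approx-weights n ω₁ ω₂ 𝓐? 𝓑? = cong₂ ℚ._+_ (approx-weight n ω₁ 𝓐?) (approx-weight n ω₂ 𝓑?)

≤-⊔ℝˡ : ∀ n x y → approx x n ℚ.≤ approx (x ⊔ℝ y) n
≤-⊔ℝˡ n x y = ℚ.p≤p⊔q (approx x n) (approx y n)

≤-⊔ℝʳ : ∀ n x y → approx y n ℚ.≤ approx (x ⊔ℝ y) n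
≤-⊔ℝʳ n x y = ℚ.p≤q⊔p (approx x n) (approx y n)

theorem3p6 : ∀ (k ℓ ℓ′ t : ℕ) → k ≥ ℓ → ℓ ≥ ℓ′ → ℓ′ ≥ t → t ≥ 1 →
    (𝓕 𝓖 : Family k) (𝓕? : Decidable 𝓕) (𝓖? : Decidable 𝓖) →
    (∀ {F} → F ∈ 𝓕 → ∣ F ∣ ≤ ℓ) → (∀ {G} → G ∈ 𝓖 → ∣ G ∣ ≤ ℓ′) →
    Satisfiable 𝓕 → Satisfiable 𝓖 →
    CrossIntersecting t 𝓕 𝓖 →
    (ω₁ ω₂ : Fin (suc k) → ℝ) →
    NonNegative ω₁ → NonNegative ω₂ →
    NonIncreasing ω₁ → NonIncreasing ω₂ →
    weight ω₁ 𝓕? +ℝ weight ω₂ 𝓖?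
    ≤ℝ max[ t , ℓ′ ] (λ a → weight ω₁ (𝓚? k a ℓ t) +ℝ weight ω₂ (𝓢? k a ℓ′))
    ⊔ℝ max[ t , ℓ ] (λ a → weight ω₁ (𝓢? k a ℓ) +ℝ weight ω₂ (𝓚? k a ℓ′ t))
theorem3p6 k ℓ ℓ′ t ℓ≤k ℓ′≤ℓ _ _ 𝓕 𝓖 𝓕? 𝓖? 𝓕-size 𝓖-size 𝓕≠∅ 𝓖≠∅ cross-t
  ω₁ ω₂ ω₁≥0 ω₂≥0 ω₁-decr ω₂-decr ε 0<ε =
  -- The error budget: each of the two weights may lose `½ ε`, spread as `c` over the `2 ^ k`
  -- subsets, and `δ` is small enough for the largest correction `total (suc k) δ` to stay within
  -- `c`.
  let c , 0<c , total-c≤½ε = total-small k (0<½ε 0<ε)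
      δ , 0<δ , total-δ≤c  = total-small (suc k) 0<c
  in eventually-zip (λ {n} → at n c total-c≤½ε δ (ℚ.<⇒≤ 0<δ) total-δ≤c)
       (eventually-decreasing ω₁ ω₁≥0 ω₁-decr 0<δ ℓ≤k (ℚ.<⇒≤ 0<δ))
       (eventually-decreasing ω₂ ω₂≥0 ω₂-decr 0<δ ℓ′≤k (ℚ.<⇒≤ 0<δ))
  where
  ℓ′≤k : ℓ′ ≤ k
  ℓ′≤k = ℕ.≤-trans ℓ′≤ℓ ℓ≤k

  KS SK : ℕ → ℝ
  KS a = weight ω₁ (𝓚? k a ℓ t) +ℝ weight ω₂ (𝓢? k a ℓ′)
  SK a = weight ω₁ (𝓢? k a ℓ) +ℝ weight ω₂ (𝓚? k a ℓ′ t)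

  maxKS maxSK : ℝ
  maxKS = max[ t , ℓ′ ] KS
  maxSK = max[ t , ℓ ] SK

  adm : Admissible t ℓ ℓ′ 𝓕 𝓖
  adm = record { size₁ = 𝓕-size ; size₂ = 𝓖-size ; nonempty₁ = 𝓕≠∅ ; nonempty₂ = 𝓖≠∅ ; cross = cross-t }

  module _ (n : ℕ) (c : ℚ) (total-c≤½ε : total k c ℚ.≤ ½ ℚ.* ε)
           (δ : ℚ) (0≤δ : 0ℚ ℚ.≤ δ) (total-δ≤c : total (suc k) δ ℚ.≤ c) where

    module P₁ = Perturb δ 0≤δ ℓ ℓ≤k (λ i → approx (ω₁ i) n)
    module P₂ = Perturb δ 0≤δ ℓ′ ℓ′≤k (λ i → approx (ω₂ i) n)

    lower : approx (weight ω₁ 𝓕? +ℝ weight ω₂ 𝓖?) n ℚ.≤ wt P₁.perturb 𝓕? ℚ.+ wt P₂.perturb 𝓖?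
    lower = ℚ.≤-trans (ℚ.≤-reflexive (approx-weights n ω₁ ω₂ 𝓕? 𝓖?))
      (ℚ.+-mono-≤ (P₁.wt-perturb-lower 𝓕? 𝓕-size) (P₂.wt-perturb-lower 𝓖? 𝓖-size))

    +-½ε : ∀ {p q} r s → p ℚ.≤ r ℚ.+ total k c → q ℚ.≤ s ℚ.+ total k c → p ℚ.+ q ℚ.≤ (r ℚ.+ s) ℚ.+ ε
    +-½ε {p} {q} r s p≤ q≤ = begin
      p ℚ.+ q                                     ≤⟨ ℚ.+-mono-≤ p≤ q≤ ⟩
      (r ℚ.+ total k c) ℚ.+ (s ℚ.+ total k c)     ≡⟨ interchange r (total k c) s (total k c) ⟩
      (r ℚ.+ s) ℚ.+ (total k c ℚ.+ total k c)     ≤⟨ ℚ.+-monoʳ-≤ (r ℚ.+ s) (ℚ.+-mono-≤ total-c≤½ε total-c≤½ε) ⟩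
      (r ℚ.+ s) ℚ.+ (½ ℚ.* ε ℚ.+ ½ ℚ.* ε)         ≡⟨ cong ((r ℚ.+ s) ℚ.+_) (½ε+½ε≡ε ε) ⟩
      (r ℚ.+ s) ℚ.+ ε                             ∎
      where open ℚ.≤-Reasoning

    upperKS : ∀ a → wt P₁.perturb (Meets? {k} a t) ℚ.+ wt P₂.perturb (Contains? {k} a) ℚ.≤
      approx (KS a) n ℚ.+ ε
    upperKS a = ℚ.≤-trans
      (+-½ε (sumAt n ω₁ (𝓚? k a ℓ t)) (sumAt n ω₂ (𝓢? k a ℓ′))
        (P₁.wt-perturb-upper (Meets? a t) total-δ≤c) (P₂.wt-perturb-upper (Contains? a) total-δ≤c))
      (ℚ.≤-reflexive (cong (ℚ._+ ε) (sym (approx-weights n ω₁ ω₂ (𝓚? k a ℓ t) (𝓢? k a ℓ′)))))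

    upperSK : ∀ a → wt P₁.perturb (Contains? {k} a) ℚ.+ wt P₂.perturb (Meets? {k} a t) ℚ.≤
      approx (SK a) n ℚ.+ ε
    upperSK a = ℚ.≤-trans
      (+-½ε (sumAt n ω₁ (𝓢? k a ℓ)) (sumAt n ω₂ (𝓚? k a ℓ′ t))
        (P₁.wt-perturb-upper (Contains? a) total-δ≤c) (P₂.wt-perturb-upper (Meets? a t) total-δ≤c))
      (ℚ.≤-reflexive (cong (ℚ._+ ε) (sym (approx-weights n ω₁ ω₂ (𝓢? k a ℓ) (𝓚? k a ℓ′ t)))))

    at : Decreasing P₁.perturb → Decreasing P₂.perturb →
      approx (weight ω₁ 𝓕? +ℝ weight ω₂ 𝓖?) n ℚ.≤ approx (maxKS ⊔ℝ maxSK) n ℚ.+ ε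
    at d₁ d₂ = [ atKS , atSK ]′ (claim k d₁ d₂ 𝓕? 𝓖? adm)
      where
      atKS : ExtremalBound k t ℓ′ P₁.perturb P₂.perturb (wt P₁.perturb 𝓕? ℚ.+ wt P₂.perturb 𝓖?) →
        approx (weight ω₁ 𝓕? +ℝ weight ω₂ 𝓖?) n ℚ.≤ approx (maxKS ⊔ℝ maxSK) n ℚ.+ ε
      atKS (extremalBound a t≤a a≤ℓ′ _ v≤) = ℚ.≤-trans (ℚ.≤-trans lower v≤) (ℚ.≤-trans (upperKS a)
        (ℚ.+-monoˡ-≤ ε (ℚ.≤-trans (max-upper n KS t≤a a≤ℓ′) (≤-⊔ℝˡ n maxKS maxSK))))
      atSK : ExtremalBound k t ℓ P₂.perturb P₁.perturb (wt P₁.perturb 𝓕? ℚ.+ wt P₂.perturb 𝓖?) →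
        approx (weight ω₁ 𝓕? +ℝ weight ω₂ 𝓖?) n ℚ.≤ approx (maxKS ⊔ℝ maxSK) n ℚ.+ ε
      atSK (extremalBound a t≤a a≤ℓ _ v≤) = ℚ.≤-trans (ℚ.≤-trans lower v≤) (ℚ.≤-trans
        -- This alternative lists the `Meets` term first, with the second weight, whereas `SK` lists
        -- the first weight first.
        (ℚ.≤-reflexive (ℚ.+-comm (wt P₂.perturb (Meets? {k} a t)) (wt P₁.perturb (Contains? {k} a))))
        (ℚ.≤-trans (upperSK a)
          (ℚ.+-monoˡ-≤ ε (ℚ.≤-trans (max-upper n SK t≤a a≤ℓ) (≤-⊔ℝʳ n maxKS maxSK)))))
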